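{- Let $k\ge1$ and let $n_1,\dots,n_k\geq 2$ be integers. Then $\text{sat}^*(n,K_{n_1,\dots,n_k})=O(n)$.
   Context: $K_{n_1,\dots,n_k}$ denotes the complete $k$-layered poset: its elements are partitioned into layers $L_1,\dots,L_k$ with $|L_i|=n_i$ ($L_1$ the bottom layer), each layer is an antichain, and $x<y$ whenever $x\in L_i$, $y\in L_j$ with $i<j$. A poset $\mathcal Q$ contains an induced copy of a poset $\mathcal P$ if there is an injective map $f:\mathcal P\to\mathcal Q$ with $f(x)\le f(y)$ iff $x\le y$. A family $\mathcal F$ of subsets of $[n]$ (ordered by inclusion) is $\mathcal P$-saturated if $\mathcal F$ contains no induced copy of $\mathcal P$ but for every $S\subseteq[n]$ with $S\notin\mathcal F$, $\mathcal F\cup\{S\}$ contains an induced copy of $\mathcal P$; $\text{sat}^*(n,\mathcal P)$ is the minimum size of such a family. -}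

module Defs where

open import Data.Nat using (ℕ; _≤_; _*_)
open import Data.Fin using (Fin) renaming (_<_ to _<ᶠ_)
open import Data.Fin.Subset using (Subset; _⊆_)
open import Data.List using (List; _∷_; length)
open import Data.List.Membership.Propositional using (_∈_; _∉_)
open import Data.List.Relation.Unary.Unique.Propositional using (Unique)
open import Data.Product using (Σ; Σ-syntax; _×_; proj₁)
open import Data.Sum using (_⊎_)
open import Relation.Binary.PropositionalEquality using (_≡_)
open import Relation.Nullary using (¬_)
open import Function.Bundles using (_⇔_)

-- Complete k-layered poset K_{ns 0, ..., ns (k-1)}:
-- an element is a layer index i (layer 0 = bottom) together with an
-- index inside that layer (layer i has ns i elements).
KElem : (k : ℕ) → (Fin k → ℕ) → Set
KElem k ns = Σ[ i ∈ Fin k ] Fin (ns i)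

_≤K_ : {k : ℕ} {ns : Fin k → ℕ} → KElem k ns → KElem k ns → Set
x ≤K y = (x ≡ y) ⊎ (proj₁ x <ᶠ proj₁ y)

-- A family of subsets of [n] is a duplicate-free list of subsets.
Family : ℕ → Set
Family n = List (Subset n)

ContainsInducedK : (n k : ℕ) → (Fin k → ℕ) → Family n → Set
ContainsInducedK n k ns F =
  Σ[ f ∈ (KElem k ns → Subset n) ]
    ((∀ x → f x ∈ F)
    × (∀ x y → f x ≡ f y → x ≡ y)
    × (∀ x y → (f x ⊆ f y) ⇔ (x ≤K y)))

Saturated : (n k : ℕ) → (Fin k → ℕ) → Family n → Set
Saturated n k ns F =
  ¬ ContainsInducedK n k ns F
  × (∀ (S : Subset n) → S ∉ F → ContainsInducedK n k ns (S ∷ F))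

{-# OPTIONS --safe #-}

-- Let m bound all layer sizes and ρ i = (k − i) m, and fix a chain of bounded-size sets
-- ∅ = S 0 ⊆ S 1 ⊆ … ⊆ S k with |S (i+1) ∖ S i| ≥ ρ i. For layers i < k consider
--   Lo i :  X ⊆ S (i+1),  |S (i+1) ∖ X| = ρ (i+1),  |S i ∖ X| < ρ (i+1),
--   Up i :  ∁X ⊆ S i,  |∁X| = ρ i − 1.
-- Climbing through a tower of layers with two elements each that uses only such sets, the
-- deficit |S i ∖ X| of a set X above the layers below i stays less than ρ i as long as these
-- layers are in Lo; dually it is at least ρ i for X below the layers from i on when those are
-- in Up, and no layer can mix the two kinds. Since the deficit cannot be less than ρ k = 0,
-- the scaffolding avoids even K_{2,…,2}.
-- Conversely, for every X there is an i with |S i ∖ X| < ρ i and |S (i+1) ∖ X| ≥ ρ (i+1); then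
-- layers of m sets from Lo 0, …, Lo (i−1) fit below X and from Up (i+1), …, Up (k−1) above it,
-- and where they are found depends only on S k ∩ X. So a K-free family containing the
-- scaffolding has at most m members with a given cardinality and a given trace on S k, and
-- completing the scaffolding greedily to a saturated family yields at most (n+1) 2^|S k| m sets.
module Submission where

open import Defs
open import Data.Bool.Properties using (not-involutive) renaming (_≟_ to _≟ᵇ_)
open import Data.Empty using (⊥-elim)
open import Data.Nat using (ℕ; zero; suc; _+_; _*_; _∸_; _^_; _⊔_; _≤_; _<_; z≤n; s≤s; s≤s⁻¹; z<s)
open import Data.Nat.Properties
open import Data.Fin using (Fin; zero; suc; toℕ; fromℕ<; inject≤)
import Data.Fin.Properties as Fin
open import Data.Fin.Subset
open import Data.Fin.Subset.Properties
open import Data.List using (List; []; _∷_; _++_; map; length; filter; lookup; upTo; deduplicate)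
open import Data.List.Properties using (length-map; length-++; length-upTo)
open import Data.List.Membership.Propositional using () renaming (_∈_ to _∈ˡ_; _∉_ to _∉ˡ_)
open import Data.List.Membership.Propositional.Properties
  using (∈-map⁺; ∈-++⁺ˡ; ∈-++⁺ʳ; ∈-filter⁺; ∈-filter⁻; ∈-lookup; ∈-upTo⁺; ∈-deduplicate⁺; ∈-deduplicate⁻)
open import Data.List.Membership.DecPropositional using () renaming (_∈?_ to member?)
open import Data.List.Relation.Unary.Any using (here; there)
import Data.List.Relation.Unary.All as All
open import Data.List.Relation.Unary.All.Properties using (¬Any⇒All¬)
open import Data.List.Relation.Unary.AllPairs using (_∷_)
open import Data.List.Relation.Unary.Unique.Propositional using (Unique)
open import Data.List.Relation.Unary.Unique.Propositional.Properties using (filter⁺)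
open import Data.List.Relation.Unary.Unique.DecPropositional.Properties using (deduplicate-!)
open import Data.Product using (Σ-syntax; ∃; _×_; _,_; proj₁; proj₂; uncurry)
import Data.Product.Properties as Product
open import Data.Sum using (_⊎_; inj₁; inj₂; [_,_])
open import Data.Vec using ([]; _∷_; here; there)
import Data.Vec.Properties as Vec
open import Function using (_∘_; _∋_)
open import Function.Bundles using (_⇔_; mk⇔; Equivalence)
open import Relation.Binary.Definitions using (tri<; tri≈; tri>)
open import Relation.Binary.PropositionalEquality hiding ([_])
open import Relation.Nullary using (¬_; Dec; yes; no; contradiction)
open import Relation.Nullary.Decidable using (_×-dec_; _⊎-dec_; _→-dec_; map′; ¬?)

-- Finite subsets

private variable
  n : ℕ
  x : Fin n
  p q : Subset n

x∈p─q⁻ : ∀ (p q : Subset n) → x ∈ p ─ q → x ∈ p × x ∉ q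
x∈p─q⁻ (inside  ∷ p) (outside ∷ q) here      = here , λ ()
x∈p─q⁻ {x = zero} (outside ∷ p) (outside ∷ q) ()
x∈p─q⁻ {x = zero} (_       ∷ p) (inside  ∷ q) ()
x∈p─q⁻ (_       ∷ p) (_       ∷ q) (there h) with x∈p , x∉q ← x∈p─q⁻ p q h =
  there x∈p , λ { (there x∈q) → x∉q x∈q }

p─q⊆∁q : ∀ (p q : Subset n) → p ─ q ⊆ ∁ q
p─q⊆∁q p q x∈ = x∉p⇒x∈∁p (proj₂ (x∈p─q⁻ p q x∈))

p─-mono : ∀ (r : Subset n) → p ⊆ q → p ─ r ⊆ q ─ r
p─-mono {p = p} r p⊆q h with x∈p , x∉r ← x∈p─q⁻ p r h = x∈p∧x∉q⇒x∈p─q (p⊆q x∈p) x∉r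

─p-antimono : ∀ (r : Subset n) → p ⊆ q → r ─ q ⊆ r ─ p
─p-antimono {q = q} r p⊆q h with x∈r , x∉q ← x∈p─q⁻ r q h = x∈p∧x∉q⇒x∈p─q x∈r (x∉q ∘ p⊆q)

∣p∣≤∣p─q∣+∣q∣ : ∀ (p q : Subset n) → ∣ p ∣ ≤ ∣ p ─ q ∣ + ∣ q ∣
∣p∣≤∣p─q∣+∣q∣ []            []            = z≤n
∣p∣≤∣p─q∣+∣q∣ (outside ∷ p) (outside ∷ q) = ∣p∣≤∣p─q∣+∣q∣ p q
∣p∣≤∣p─q∣+∣q∣ (outside ∷ p) (inside  ∷ q) =
  ≤-trans (∣p∣≤∣p─q∣+∣q∣ p q) (+-monoʳ-≤ ∣ p ─ q ∣ (n≤1+n _))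
∣p∣≤∣p─q∣+∣q∣ (inside  ∷ p) (outside ∷ q) = s≤s (∣p∣≤∣p─q∣+∣q∣ p q)
∣p∣≤∣p─q∣+∣q∣ (inside  ∷ p) (inside  ∷ q) =
  subst (suc ∣ p ∣ ≤_) (sym (+-suc ∣ p ─ q ∣ ∣ q ∣)) (s≤s (∣p∣≤∣p─q∣+∣q∣ p q))

∣p─q∣+∣q∣≡∣p∣ : q ⊆ p → ∣ p ─ q ∣ + ∣ q ∣ ≡ ∣ p ∣
∣p─q∣+∣q∣≡∣p∣ {q = []}          {p = []}          _   = refl
∣p─q∣+∣q∣≡∣p∣ {q = outside ∷ q} {p = outside ∷ p} q⊆p = ∣p─q∣+∣q∣≡∣p∣ (drop-∷-⊆ q⊆p)
∣p─q∣+∣q∣≡∣p∣ {q = outside ∷ q} {p = inside  ∷ p} q⊆p = cong suc (∣p─q∣+∣q∣≡∣p∣ (drop-∷-⊆ q⊆p))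
∣p─q∣+∣q∣≡∣p∣ {q = inside  ∷ q} {p = outside ∷ p} q⊆p with () ← q⊆p here
∣p─q∣+∣q∣≡∣p∣ {q = inside  ∷ q} {p = inside  ∷ p} q⊆p =
  trans (+-suc ∣ p ─ q ∣ ∣ q ∣) (cong suc (∣p─q∣+∣q∣≡∣p∣ (drop-∷-⊆ q⊆p)))

1+∣p-x∣≡∣p∣ : x ∈ p → suc ∣ p - x ∣ ≡ ∣ p ∣
1+∣p-x∣≡∣p∣ {x = x} {p = p} x∈p = trans (+-comm 1 _)
  (trans (cong (∣ p - x ∣ +_) (sym (∣⁅x⁆∣≡1 x)))
    (∣p─q∣+∣q∣≡∣p∣ λ h → subst (_∈ p) (sym (x∈⁅y⁆⇒x≡y x h)) x∈p))

x∈p-y⁻ : ∀ (p : Subset n) {y} → x ∈ p - y → x ∈ p × x ≢ y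
x∈p-y⁻ p {y} h with x∈p , x∉⁅y⁆ ← x∈p─q⁻ p ⁅ y ⁆ h = x∈p , x∉⁅y⁆⇒x≢y x∉⁅y⁆

∁-involutive : ∀ (p : Subset n) → ∁ (∁ p) ≡ p
∁-involutive []      = refl
∁-involutive (s ∷ p) = cong₂ _∷_ (not-involutive s) (∁-involutive p)

⊆∧∣≥∣⇒⊇ : p ⊆ q → ∣ q ∣ ≤ ∣ p ∣ → q ⊆ p
⊆∧∣≥∣⇒⊇ {p = p} p⊆q ∣q∣≤∣p∣ {x} x∈q with x ∈? p
... | yes x∈p = x∈p
... | no  x∉p = contradiction ∣q∣≤∣p∣ (<⇒≱ (p⊂q⇒∣p∣<∣q∣ (p⊆q , x , x∈q , x∉p)))

∣∣-between : ∀ r → q ⊆ p → ∣ q ∣ ≤ r → r ≤ ∣ p ∣ →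
  Σ[ s ∈ Subset n ] (q ⊆ s × s ⊆ p × ∣ s ∣ ≡ r)
∣∣-between {q = []} {p = []} zero _ _ _ = [] , ⊆-refl , ⊆-refl , refl
∣∣-between {q = outside ∷ q} {p = outside ∷ p} r q⊆p ≤r r≤
  with s , q⊆s , s⊆p , eq ← ∣∣-between r (drop-∷-⊆ q⊆p) ≤r r≤ =
  outside ∷ s , s⊆s q⊆s , s⊆s s⊆p , eq
∣∣-between {q = outside ∷ q} {p = inside ∷ p} r q⊆p ≤r r≤ with r ≤? ∣ p ∣
... | yes r≤∣p∣ with s , q⊆s , s⊆p , eq ← ∣∣-between r (drop-∷-⊆ q⊆p) ≤r r≤∣p∣ =
  outside ∷ s , s⊆s q⊆s , out⊆ s⊆p , eq
... | no  r≰∣p∣ = inside ∷ p , q⊆p , ⊆-refl , ≤-antisym (≰⇒> r≰∣p∣) r≤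
∣∣-between {q = inside ∷ q} {p = outside ∷ p} r q⊆p _ _ with () ← q⊆p here
∣∣-between {q = inside ∷ q} {p = inside ∷ p} (suc r) q⊆p (s≤s ≤r) (s≤s r≤)
  with s , q⊆s , s⊆p , eq ← ∣∣-between r (drop-∷-⊆ q⊆p) ≤r r≤ =
  inside ∷ s , s⊆s q⊆s , s⊆s s⊆p , cong suc eq

choose : ∀ m (p : Subset n) → m ≤ ∣ p ∣ →
  Σ[ e ∈ (Fin m → Fin n) ] ((∀ a → e a ∈ p) × (∀ a b → e a ≡ e b → a ≡ b))
choose zero    p             _  = (λ ()) , (λ ()) , λ ()
choose (suc m) (outside ∷ p) m≤ with e , e∈ , inj ← choose (suc m) p m≤ =
  suc ∘ e , there ∘ e∈ , λ a b → inj a b ∘ Fin.suc-injective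
choose (suc m) (inside ∷ p) (s≤s m≤) with e , e∈ , inj ← choose m p m≤ =
  (λ { zero → zero ; (suc a) → suc (e a) })
  , (λ { zero → here ; (suc a) → there (e∈ a) })
  , λ { zero zero _ → refl
      ; zero (suc _) ()
      ; (suc _) zero ()
      ; (suc a) (suc b) eq → cong suc (inj a b (Fin.suc-injective eq)) }

initial : ∀ n → ℕ → Subset n
initial zero    _       = []
initial (suc n) zero    = ⊥
initial (suc n) (suc s) = inside ∷ initial n s

∣initial∣ : ∀ {n s} → s ≤ n → ∣ initial n s ∣ ≡ s
∣initial∣ {zero}  {zero}  _       = refl
∣initial∣ {suc n} {zero}  _       = ∣⊥∣≡0 n
∣initial∣ {suc n} {suc s} (s≤s h) = cong suc (∣initial∣ h)

initial-mono : ∀ n {s t} → s ≤ t → initial n s ⊆ initial n t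
initial-mono zero    _       = ⊆-refl
initial-mono (suc n) z≤n     = ⊥⊆
initial-mono (suc n) (s≤s h) = s⊆s (initial-mono n h)

powerset : Subset n → List (Subset n)
powerset []            = [] ∷ []
powerset (outside ∷ p) = map (outside ∷_) (powerset p)
powerset (inside  ∷ p) = map (outside ∷_) (powerset p) ++ map (inside ∷_) (powerset p)

length-powerset : ∀ (p : Subset n) → length (powerset p) ≡ 2 ^ ∣ p ∣
length-powerset []            = refl
length-powerset (outside ∷ p) = trans (length-map _ (powerset p)) (length-powerset p)
length-powerset (inside  ∷ p) = trans (length-++ (map (outside ∷_) (powerset p)))
  (cong₂ _+_ (trans (length-map _ (powerset p)) (length-powerset p))
             (trans (length-map _ (powerset p))
                    (trans (length-powerset p) (sym (+-identityʳ _)))))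

∈-powerset : q ⊆ p → q ∈ˡ powerset p
∈-powerset {q = []}          {p = []}          _   = here refl
∈-powerset {q = outside ∷ q} {p = outside ∷ p} q⊆p = ∈-map⁺ _ (∈-powerset (drop-∷-⊆ q⊆p))
∈-powerset {q = outside ∷ q} {p = inside  ∷ p} q⊆p = ∈-++⁺ˡ (∈-map⁺ _ (∈-powerset (drop-∷-⊆ q⊆p)))
∈-powerset {q = inside  ∷ q} {p = outside ∷ p} q⊆p with () ← q⊆p here
∈-powerset {q = inside  ∷ q} {p = inside  ∷ p} q⊆p =
  ∈-++⁺ʳ (map (outside ∷_) (powerset p)) (∈-map⁺ _ (∈-powerset (drop-∷-⊆ q⊆p)))

-- Towers of antichains

-- Layers are indexed by `ℕ` and constrained only for `lo ≤ i < hi`, so that stacking needs no `Fin`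
-- arithmetic; `D` and `E` are the bounds along which towers are stacked. Non-inclusions between
-- different layers are left implicit: they follow from `antichain` and `monotone` once a layer has
-- two members.
record Tower {n : ℕ} (P : Subset n → Set) (m lo hi : ℕ) (D E : Subset n) : Set where
  field
    layer     : ℕ → Fin m → Subset n
    member    : ∀ {i} a → lo ≤ i → i < hi → P (layer i a)
    lower     : ∀ {i} a → lo ≤ i → i < hi → D ⊆ layer i a
    upper     : ∀ {i} a → lo ≤ i → i < hi → layer i a ⊆ E
    antichain : ∀ {i} a b → lo ≤ i → i < hi → layer i a ⊆ layer i b → a ≡ b
    monotone  : ∀ {i j} a b → lo ≤ i → i < j → j < hi → layer i a ⊆ layer j b

module _ {n m : ℕ} {P : Subset n → Set} where

  emptyTower : ∀ {i D E} → Tower P m i i D E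
  emptyTower = record
    { layer     = λ _ _ → ⊥
    ; member    = λ _ l h → contradiction l (<⇒≱ h)
    ; lower     = λ _ l h → contradiction l (<⇒≱ h)
    ; upper     = λ _ l h → contradiction l (<⇒≱ h)
    ; antichain = λ _ _ l h → contradiction l (<⇒≱ h)
    ; monotone  = λ _ _ l i<j h → contradiction l (<⇒≱ (<-trans i<j h))
    }

  singleTower : ∀ {i D E} (X : Fin m → Subset n) → (∀ a → P (X a)) →
    (∀ a → D ⊆ X a) → (∀ a → X a ⊆ E) → (∀ a b → X a ⊆ X b → a ≡ b) →
    Tower P m i (suc i) D E
  singleTower X mem lo up anti = record
    { layer     = λ _ → X
    ; member    = λ a _ _ → mem a
    ; lower     = λ a _ _ → lo a
    ; upper     = λ a _ _ → up a
    ; antichain = λ a b _ _ → anti a b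
    ; monotone  = λ _ _ l i<j h → contradiction l (<⇒≱ (<-≤-trans i<j (s≤s⁻¹ h)))
    }

  mapTower : ∀ {Q : Subset n → Set} {i j D E} → (∀ {X} → P X → Q X) →
    Tower P m i j D E → Tower Q m i j D E
  mapTower f t = record
    { layer = layer ; member = λ a l h → f (member a l h)
    ; lower = lower ; upper = upper ; antichain = antichain ; monotone = monotone }
    where open Tower t

  module _ {lo mid hi : ℕ} {C D D′ E : Subset n}
    (C⊆D′ : C ⊆ D′) (D⊆D′ : D ⊆ D′) (D⊆E : D ⊆ E)
    (t : Tower P m lo mid C D) (u : Tower P m mid hi D′ E) where
    private
      module t = Tower t
      module u = Tower u

      -- The decision is an explicit argument, so that each field of `glue` can be proved by
      -- matching on it.
      select : ∀ {i} → Dec (i < mid) → Fin m → Subset n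
      select {i} (yes _) = t.layer i
      select {i} (no  _) = u.layer i

    glue : Tower P m lo hi C E
    glue = record
      { layer = λ i → select (i <? mid)
      ; member = λ {i} a l h → mem a (i <? mid) l h
      ; lower  = λ {i} a l h → low a (i <? mid) l h
      ; upper  = λ {i} a l h → up a (i <? mid) l h
      ; antichain = λ {i} a b l h → anti a b (i <? mid) l h
      ; monotone  = λ {i} {j} a b l i<j h → mono a b (i <? mid) (j <? mid) l i<j h
      }
      where
      mem : ∀ {i} a (d : Dec (i < mid)) → lo ≤ i → i < hi → P (select d a)
      mem a (yes p) l h = t.member a l p
      mem a (no ¬p) l h = u.member a (≮⇒≥ ¬p) h
      low : ∀ {i} a (d : Dec (i < mid)) → lo ≤ i → i < hi → C ⊆ select d a
      low a (yes p) l h = t.lower a l p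
      low a (no ¬p) l h = ⊆-trans C⊆D′ (u.lower a (≮⇒≥ ¬p) h)
      up : ∀ {i} a (d : Dec (i < mid)) → lo ≤ i → i < hi → select d a ⊆ E
      up a (yes p) l h = ⊆-trans (t.upper a l p) D⊆E
      up a (no ¬p) l h = u.upper a (≮⇒≥ ¬p) h
      anti : ∀ {i} a b (d : Dec (i < mid)) → lo ≤ i → i < hi → select d a ⊆ select d b → a ≡ b
      anti a b (yes p) l h = t.antichain a b l p
      anti a b (no ¬p) l h = u.antichain a b (≮⇒≥ ¬p) h
      mono : ∀ {i j} a b (d : Dec (i < mid)) (e : Dec (j < mid)) →
        lo ≤ i → i < j → j < hi → select d a ⊆ select e b
      mono a b (yes p) (yes q) l i<j h = t.monotone a b l i<j q
      mono a b (yes p) (no ¬q) l i<j h =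
        ⊆-trans (t.upper a l p) (⊆-trans D⊆D′ (u.lower b (≮⇒≥ ¬q) h))
      mono a b (no ¬p) (yes q) l i<j h = contradiction (<-trans i<j q) ¬p
      mono a b (no ¬p) (no ¬q) l i<j h = u.monotone a b (≮⇒≥ ¬p) i<j h

-- The scaffolding

module Threshold (k : ℕ) {m : ℕ} (0<m : 0 < m) where

  ρ : ℕ → ℕ
  ρ i = (k ∸ i) * m

  ρ-antimono : ∀ {i j} → i ≤ j → ρ j ≤ ρ i
  ρ-antimono i≤j = *-monoˡ-≤ m (∸-monoʳ-≤ k i≤j)

  ρ-step : ∀ {i} → i < k → ρ i ≡ m + ρ (suc i)
  ρ-step {i} i<k = cong (_* m) (+-∸-assoc 1 i<k)

  ρk≡0 : ρ k ≡ 0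
  ρk≡0 = cong (_* m) (n∸n≡0 k)

  ρ-strict : ∀ {i j} → i < k → i < j → ρ j < ρ i
  ρ-strict {i} i<k i<j = ≤-<-trans (ρ-antimono i<j)
    (subst (ρ (suc i) <_) (sym (ρ-step i<k)) (m<n+m (ρ (suc i)) 0<m))

  -- Cardinalities of the chain chosen in the end: it starts at the empty set and its gaps are
  -- exactly `ρ i`.
  size : ℕ → ℕ
  size zero    = 0
  size (suc i) = size i + ρ i

  size-mono : ∀ {i j} → i ≤ j → size i ≤ size j
  size-mono {j = zero}  z≤n = z≤n
  size-mono {i} {suc j} i≤j with m≤n⇒m<n∨m≡n i≤j
  ... | inj₁ i<j  = ≤-trans (size-mono (s≤s⁻¹ i<j)) (m≤m+n (size j) (ρ j))
  ... | inj₂ refl = ≤-refl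

module Scaffold {n : ℕ} (k : ℕ) {m : ℕ} (0<m : 0 < m) (S : ℕ → Subset n) where
  open Threshold k 0<m

  -- The sizes are tuned to pairs of incomparable sets. Two distinct complements of size `ρ (suc i)`
  -- inside `S (suc i)` meet in fewer than `ρ (suc i)` points, and two distinct complements of size
  -- one less than `ρ i` have a union of at least `ρ i` points. The last clause of `Lo` controls the
  -- smaller sets of the chain when a set of `Lo j` occurs in a layer below `j`.
  Lo Up Scaffolding : ℕ → Subset n → Set
  Lo i X = X ⊆ S (suc i) × ∣ S (suc i) ─ X ∣ ≡ ρ (suc i) × ∣ S i ─ X ∣ < ρ (suc i)
  Up i X = ∁ X ⊆ S i × suc ∣ ∁ X ∣ ≡ ρ i
  Scaffolding i X = Lo i X ⊎ Up i X

  Base : Subset n → Set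
  Base X = ∃ λ i → i < k × Scaffolding i X

  base? : ∀ X → Dec (Base X)
  base? X = anyUpTo? scaffolding? k
    where
    scaffolding? : ∀ i → Dec (Scaffolding i X)
    scaffolding? i =
      (X ⊆? S (suc i) ×-dec ∣ S (suc i) ─ X ∣ ≟ ρ (suc i) ×-dec ∣ S i ─ X ∣ <? ρ (suc i))
      ⊎-dec (∁ X ⊆? S i ×-dec suc ∣ ∁ X ∣ ≟ ρ i)

  -- Completing one antichain to a full tower with scaffolding sets

  module Embed (S-mono : ∀ {i j} → i ≤ j → S i ⊆ S j)
    (S-gap : ∀ {i} → i < k → ρ i ≤ ∣ S (suc i) ─ S i ∣) where

    ρ≤∣S∣ : ∀ {i} → i < k → ρ (suc i) ≤ ∣ S (suc i) ∣
    ρ≤∣S∣ {i} i<k = ≤-trans (ρ-antimono (n≤1+n i))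
      (≤-trans (S-gap i<k) (∣p─q∣≤∣p∣ (S (suc i)) (S i)))

    -- The gap has at least `ρ i`, that is `m + ρ (suc i)`, points, and `Q` has only `ρ (suc i)`
    -- minus one; this leaves the `m` points that tell the members of a lower layer apart.
    gap─ : ∀ {i r Q} → i < k → ρ (suc i) ≡ suc r → ∣ Q ∣ ≡ r → m ≤ ∣ S (suc i) ─ S i ─ Q ∣
    gap─ {i} {r} {Q} i<k ρ≡ ∣Q∣≡r = +-cancelʳ-≤ r m _ (begin
      m + r                                  ≤⟨ +-monoʳ-≤ m (n≤1+n r) ⟩
      m + suc r                              ≡⟨ cong (m +_) ρ≡ ⟨
      m + ρ (suc i)                          ≡⟨ ρ-step i<k ⟨
      ρ i                                    ≤⟨ S-gap i<k ⟩
      ∣ S (suc i) ─ S i ∣                    ≤⟨ ∣p∣≤∣p─q∣+∣q∣ (S (suc i) ─ S i) Q ⟩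
      ∣ S (suc i) ─ S i ─ Q ∣ + ∣ Q ∣        ≡⟨ cong (∣ S (suc i) ─ S i ─ Q ∣ +_) ∣Q∣≡r ⟩
      ∣ S (suc i) ─ S i ─ Q ∣ + r            ∎)
      where open ≤-Reasoning

    -- Enlarge S (i+1) ─ T inside S (i+1) to a set Q of size ρ (i+1) − 1; the layer consists of the
    -- sets S (i+1) ─ Q with one further point of S (i+1) ─ S i removed.
    lowerLayer : ∀ {i T} → i < k → ∣ S (suc i) ─ T ∣ < ρ (suc i) →
      Σ[ D ∈ Subset n ] (D ⊆ T × ∣ S i ─ D ∣ < ρ i × Tower Base m i (suc i) D T)
    lowerLayer {i} {T} i<k h with ρ (suc i) in ρ≡ | h
    ... | suc r | s≤s ∣Q∣≤r
      with Q , S─T⊆Q , Q⊆S , ∣Q∣≡r ← ∣∣-between r (p─q⊆p (S (suc i)) T) ∣Q∣≤r (≤-trans (n≤1+n r) (subst (_≤ ∣ S (suc i) ∣) ρ≡ (ρ≤∣S∣ i<k)))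
      with e , e∈ , e-inj ← choose m (S (suc i) ─ S i ─ Q) (gap─ i<k ρ≡ ∣Q∣≡r)
      = D , D⊆T , ∣S─D∣<ρ , singleTower A A-base D⊆A A⊆T A-anti
      where
      D : Subset n
      D = S i ─ Q
      A : Fin m → Subset n
      A a = S (suc i) ─ Q - e a
      S─Q⊆T : S (suc i) ─ Q ⊆ T
      S─Q⊆T {x} x∈ with x ∈? T | x∈p─q⁻ (S (suc i)) Q x∈
      ... | yes x∈T | _ = x∈T
      ... | no  x∉T | x∈S , x∉Q = contradiction (S─T⊆Q (x∈p∧x∉q⇒x∈p─q x∈S x∉T)) x∉Q
      D⊆T : D ⊆ T
      D⊆T = ⊆-trans (p─-mono Q (S-mono (n≤1+n i))) S─Q⊆T
      ∣S─D∣<ρ : ∣ S i ─ D ∣ < ρ i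
      ∣S─D∣<ρ = begin-strict
        ∣ S i ─ D ∣   ≤⟨ p⊆q⇒∣p∣≤∣q∣ S─D⊆Q ⟩
        ∣ Q ∣         ≡⟨ ∣Q∣≡r ⟩
        r             <⟨ n<1+n r ⟩
        suc r         ≡⟨ ρ≡ ⟨
        ρ (suc i)     ≤⟨ ρ-antimono (n≤1+n i) ⟩
        ρ i           ∎
        where
        open ≤-Reasoning
        S─D⊆Q : S i ─ D ⊆ Q
        S─D⊆Q {x} x∈ with x ∈? Q | x∈p─q⁻ (S i) D x∈
        ... | yes x∈Q | _ = x∈Q
        ... | no  x∉Q | x∈S , x∉D = contradiction (x∈p∧x∉q⇒x∈p─q x∈S x∉Q) x∉D
      e∈S─Q : ∀ a → e a ∈ S (suc i) ─ Q
      e∈S─Q a = p─-mono Q (p─q⊆p (S (suc i)) (S i)) (e∈ a)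
      e∉S : ∀ a → e a ∉ S i
      e∉S a = proj₂ (x∈p─q⁻ (S (suc i)) (S i) (p─q⊆p (S (suc i) ─ S i) Q (e∈ a)))
      A⊆S─Q : ∀ a → A a ⊆ S (suc i) ─ Q
      A⊆S─Q a = p─q⊆p (S (suc i) ─ Q) ⁅ e a ⁆
      A⊆S : ∀ a → A a ⊆ S (suc i)
      A⊆S a = ⊆-trans (A⊆S─Q a) (p─q⊆p (S (suc i)) Q)
      A⊆T : ∀ a → A a ⊆ T
      A⊆T a = ⊆-trans (A⊆S─Q a) S─Q⊆T
      D⊆A : ∀ a → D ⊆ A a
      D⊆A a x∈D = x∈p∧x≢y⇒x∈p-y (p─-mono Q (S-mono (n≤1+n i)) x∈D)
        λ { refl → e∉S a (p─q⊆p (S i) Q x∈D) }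
      A-anti : ∀ a b → A a ⊆ A b → a ≡ b
      A-anti a b A⊆A with a Fin.≟ b
      ... | yes a≡b = a≡b
      ... | no  a≢b = contradiction refl (proj₂ (x∈p-y⁻ (S (suc i) ─ Q) (A⊆A
        (x∈p∧x≢y⇒x∈p-y (e∈S─Q b) (a≢b ∘ sym ∘ e-inj b a)))))
      ∣S─A∣≡ρ : ∀ a → ∣ S (suc i) ─ A a ∣ ≡ ρ (suc i)
      ∣S─A∣≡ρ a = +-cancelʳ-≡ ∣ A a ∣ _ _ (begin
        ∣ S (suc i) ─ A a ∣ + ∣ A a ∣   ≡⟨ ∣p─q∣+∣q∣≡∣p∣ (A⊆S a) ⟩
        ∣ S (suc i) ∣                   ≡⟨ ∣p─q∣+∣q∣≡∣p∣ Q⊆S ⟨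
        ∣ S (suc i) ─ Q ∣ + ∣ Q ∣       ≡⟨ cong₂ _+_ (1+∣p-x∣≡∣p∣ (e∈S─Q a)) (sym ∣Q∣≡r) ⟨
        suc ∣ A a ∣ + r                 ≡⟨ cong suc (+-comm ∣ A a ∣ r) ⟩
        suc r + ∣ A a ∣                 ≡⟨ cong (_+ ∣ A a ∣) ρ≡ ⟨
        ρ (suc i) + ∣ A a ∣             ∎)
        where open ≡-Reasoning
      ∣Sᵢ─A∣<ρ : ∀ a → ∣ S i ─ A a ∣ < ρ (suc i)
      ∣Sᵢ─A∣<ρ a = begin-strict
        ∣ S i ─ A a ∣   ≤⟨ p⊆q⇒∣p∣≤∣q∣ S─A⊆Q ⟩
        ∣ Q ∣           ≡⟨ ∣Q∣≡r ⟩
        r               <⟨ n<1+n r ⟩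
        suc r           ≡⟨ ρ≡ ⟨
        ρ (suc i)       ∎
        where
        open ≤-Reasoning
        S─A⊆Q : S i ─ A a ⊆ Q
        S─A⊆Q {x} x∈ with x ∈? Q | x∈p─q⁻ (S i) (A a) x∈
        ... | yes x∈Q | _ = x∈Q
        ... | no  x∉Q | x∈S , x∉A = contradiction (D⊆A a (x∈p∧x∉q⇒x∈p─q x∈S x∉Q)) x∉A
      A-base : ∀ a → Base (A a)
      A-base a = i , i<k , inj₁ (A⊆S a , ∣S─A∣≡ρ a , ∣Sᵢ─A∣<ρ a)

    -- Shrink Z to Y of size ρ i and Y to V of size ρ (i+1); the layer consists of the complements of
    -- the sets Y with one point outside V removed.
    upperLayer : ∀ {i Z} → i < k → Z ⊆ S i → ρ i ≤ ∣ Z ∣ →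
      Σ[ V ∈ Subset n ] (V ⊆ Z × ρ (suc i) ≤ ∣ V ∣ × Tower Base m i (suc i) (∁ Z) (∁ V))
    upperLayer {i} {Z} i<k Z⊆S ρ≤
      with Y , _ , Y⊆Z , ∣Y∣≡ρ ← ∣∣-between (ρ i) ⊥⊆ (subst (_≤ ρ i) (sym (∣⊥∣≡0 n)) z≤n) ρ≤
      with V , _ , V⊆Y , ∣V∣≡ρ ← ∣∣-between (ρ (suc i)) ⊥⊆
        (subst (_≤ ρ (suc i)) (sym (∣⊥∣≡0 n)) z≤n)
        (subst (ρ (suc i) ≤_) (sym ∣Y∣≡ρ) (ρ-antimono (n≤1+n i)))
      with e , e∈ , e-inj ← choose m (Y ─ V) (+-cancelʳ-≤ (ρ (suc i)) m _
        (subst₂ _≤_ (trans ∣Y∣≡ρ (ρ-step i<k)) (cong (∣ Y ─ V ∣ +_) ∣V∣≡ρ)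
          (∣p∣≤∣p─q∣+∣q∣ Y V)))
      = V , ⊆-trans V⊆Y Y⊆Z , ≤-reflexive (sym ∣V∣≡ρ)
      , singleTower (λ a → ∁ (B a)) B-base
          (λ a → p⊆q⇒∁p⊇∁q (⊆-trans (B⊆Y a) Y⊆Z)) (λ a → p⊆q⇒∁p⊇∁q (V⊆B a)) B-anti
      where
      B : Fin m → Subset n
      B a = Y - e a
      B⊆Y : ∀ a → B a ⊆ Y
      B⊆Y a = p─q⊆p Y ⁅ e a ⁆
      V⊆B : ∀ a → V ⊆ B a
      V⊆B a x∈V = x∈p∧x≢y⇒x∈p-y (V⊆Y x∈V)
        λ { refl → proj₂ (x∈p─q⁻ Y V (e∈ a)) x∈V }
      B-anti : ∀ a b → ∁ (B a) ⊆ ∁ (B b) → a ≡ b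
      B-anti a b ∁⊆∁ with a Fin.≟ b
      ... | yes a≡b = a≡b
      ... | no  a≢b = contradiction refl (proj₂ (x∈p-y⁻ Y (∁p⊆∁q⇒p⊇q ∁⊆∁
        (x∈p∧x≢y⇒x∈p-y (proj₁ (x∈p─q⁻ Y V (e∈ a))) (a≢b ∘ e-inj a b)))))
      B-base : ∀ a → Base (∁ (B a))
      B-base a = i , i<k , inj₂ (subst (λ X → X ⊆ S i × suc ∣ X ∣ ≡ ρ i) (sym (∁-involutive (B a)))
        ( ⊆-trans (B⊆Y a) (⊆-trans Y⊆Z Z⊆S)
        , trans (1+∣p-x∣≡∣p∣ (proj₁ (x∈p─q⁻ Y V (e∈ a)))) ∣Y∣≡ρ))

    -- Built from the top down: the set `D` returned by `lowerLayer` lies below the whole new layer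
    -- and satisfies the deficit bound for `i`, so it serves as the next `T`.
    lowerTower : ∀ i {T} → i ≤ k → ∣ S i ─ T ∣ < ρ i → Tower Base m 0 i ⊥ T
    lowerTower zero    _   _ = emptyTower
    lowerTower (suc i) i<k h with D , D⊆T , h′ , t ← lowerLayer i<k h =
      glue ⊥⊆ ⊆-refl D⊆T (lowerTower i (<⇒≤ i<k) h′) t

    -- Built from the bottom up, with `d` layers to go: the set `V` left by `upperLayer` is missed
    -- by the next layers and still has the `ρ (suc i)` points they consume.
    upperTower : ∀ d {i Z} → d + i ≡ k → Z ⊆ S i → ρ i ≤ ∣ Z ∣ → Tower Base m i k (∁ Z) ⊤
    upperTower zero    refl _   _ = emptyTower
    upperTower (suc d) {i} eq Z⊆S h
      with V , V⊆Z , h′ , t ← upperLayer (subst (i <_) eq (m<n+m i z<s)) Z⊆S h =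
      glue (p⊆q⇒∁p⊇∁q V⊆Z) ⊆-refl ⊆⊤ t
        (upperTower d (trans (+-suc d i) eq) (⊆-trans V⊆Z (⊆-trans Z⊆S (S-mono (n≤1+n i)))) h′)

    -- A discrete intermediate value argument: the deficit of `Y` starts below the threshold and
    -- cannot end below `ρ k`, which is 0.
    crossing : ∀ d {i} Y → d + i ≡ k → ∣ S i ─ Y ∣ < ρ i →
      ∃ λ j → j < k × ∣ S j ─ Y ∣ < ρ j × ρ (suc j) ≤ ∣ S (suc j) ─ Y ∣
    crossing zero    Y refl h = contradiction (subst (∣ S k ─ Y ∣ <_) ρk≡0 h) n≮0
    crossing (suc d) {i} Y eq h with ∣ S (suc i) ─ Y ∣ <? ρ (suc i)
    ... | yes h′ = crossing d Y (trans (+-suc d i) eq) h′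
    ... | no  ≮ρ = i , subst (i <_) eq (m<n+m i z<s) , h , ≮⇒≥ ≮ρ

    module _ (∣S₀∣<ρ₀ : ∣ S 0 ∣ < ρ 0) {P : Subset n → Set} (base⇒P : ∀ {X} → Base X → P X) where

      -- The given sets become the layer `j` at which `Y` crosses the threshold. Their common trace
      -- `Y` on `S k` puts them above `Y` and makes them disjoint from `S (suc j) ─ Y`, so the lower
      -- tower fits under `Y` and the upper one over the complement of `S (suc j) ─ Y`, whichever
      -- the sets are outside `S k`.
      fullTower : ∀ {Y} (X : Fin m → Subset n) → (∀ a → P (X a)) →
        (∀ a → S k ∩ X a ≡ Y) → (∀ a b → X a ⊆ X b → a ≡ b) → Tower P m 0 k ⊥ ⊤
      fullTower {Y} X X∈P trace X-anti
        with j , j<k , h , h′ ← crossing k Y (+-identityʳ k) (≤-<-trans (∣p─q∣≤∣p∣ (S 0) Y) ∣S₀∣<ρ₀) =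
        glue ⊥⊆ ⊆-refl ⊆⊤
          (glue ⊥⊆ ⊆-refl Y⊆∁
            (mapTower base⇒P (lowerTower j (<⇒≤ j<k) h))
            (singleTower X X∈P Y⊆X X⊆∁ X-anti))
          (mapTower base⇒P (upperTower (k ∸ suc j) (m∸n+n≡m j<k) (p─q⊆p (S (suc j)) Y) h′))
        where
        Y⊆∁ : Y ⊆ ∁ (S (suc j) ─ Y)
        Y⊆∁ x∈Y = x∉p⇒x∈∁p λ x∈ → proj₂ (x∈p─q⁻ (S (suc j)) Y x∈) x∈Y
        Y⊆X : ∀ a → Y ⊆ X a
        Y⊆X a rewrite sym (trace a) = p∩q⊆q (S k) (X a)
        X⊆∁ : ∀ a → X a ⊆ ∁ (S (suc j) ─ Y)
        X⊆∁ a x∈X = x∉p⇒x∈∁p λ x∈ → let x∈S , x∉Y = x∈p─q⁻ (S (suc j)) Y x∈ in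
          x∉Y (subst (_ ∈_) (trace a) (x∈p∩q⁺ (S-mono j<k x∈S , x∈X)))

  -- The scaffolding contains no tower of pairs

  module Avoid (S-mono : ∀ {i j} → i ≤ j → S i ⊆ S j) (∣S₀∣<ρ₀ : ∣ S 0 ∣ < ρ 0)
    {x₀ : Fin n} (x₀∉S : x₀ ∉ S k) where

    -- If `j < i`, the `ρ (suc j)` points of `S (suc j)` missing from `X` lie in `S i` and already
    -- number at least `ρ i`.
    Lo⇒≤ : ∀ {i j X} → Lo j X → ∣ S i ─ X ∣ < ρ i → i ≤ j
    Lo⇒≤ {i} {j} {X} (_ , ∣S─X∣≡ρ , _) h = ≮⇒≥ λ j<i → <-irrefl refl (begin-strict
      ρ (suc j)            ≡⟨ ∣S─X∣≡ρ ⟨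
      ∣ S (suc j) ─ X ∣    ≤⟨ p⊆q⇒∣p∣≤∣q∣ (p─-mono X (S-mono j<i)) ⟩
      ∣ S i ─ X ∣          <⟨ h ⟩
      ρ i                  ≤⟨ ρ-antimono j<i ⟩
      ρ (suc j)            ∎)
      where open ≤-Reasoning

    -- If `i < j`, the whole complement of `X` has fewer than `ρ j`, hence fewer than `ρ (suc i)`,
    -- points.
    Up⇒≤ : ∀ {i j X} → Up j X → ρ (suc i) ≤ ∣ S (suc i) ─ X ∣ → j ≤ i
    Up⇒≤ {i} {j} {X} (_ , ∣∁X∣≡ρ) h = ≮⇒≥ λ i<j → <-irrefl refl (begin-strict
      ρ (suc i)            ≤⟨ h ⟩
      ∣ S (suc i) ─ X ∣    ≤⟨ p⊆q⇒∣p∣≤∣q∣ (p─q⊆∁q (S (suc i)) X) ⟩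
      ∣ ∁ X ∣              <⟨ n<1+n _ ⟩
      suc ∣ ∁ X ∣          ≡⟨ ∣∁X∣≡ρ ⟩
      ρ j                  ≤⟨ ρ-antimono i<j ⟩
      ρ (suc i)            ∎)
      where open ≤-Reasoning

    -- The point `x₀` outside `S k` belongs to every `Up` set and to no `Lo` set.
    Up⊈Lo : ∀ {i j X Y} → i < k → Lo i X → j < k → Up j Y → ¬ Y ⊆ X
    Up⊈Lo i<k (X⊆S , _) j<k (∁Y⊆S , _) Y⊆X =
      x₀∉S (S-mono i<k (X⊆S (Y⊆X (x∉∁p⇒x∈p λ x∈ → x₀∉S (S-mono (<⇒≤ j<k) (∁Y⊆S x∈))))))

    -- Both indices are at least `i`. If one is larger, the last clause of `Lo` for that set bounds
    -- the deficit of `Z`. If both equal `i` and the bound fails, then `Z` misses everything in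
    -- `S (suc i)` that `Y` misses; as `X` lies in `S (suc i)` and in `Z`, it would lie in `Y`.
    Lo-pair : ∀ {i j j′ X Y Z} → ∣ S i ─ X ∣ < ρ i → ∣ S i ─ Y ∣ < ρ i →
      Lo j X → Lo j′ Y → ¬ X ⊆ Y → X ⊆ Z → Y ⊆ Z → ∣ S (suc i) ─ Z ∣ < ρ (suc i)
    Lo-pair {i} {j} {j′} {X} {Y} {Z} hX hY loX loY X⊈Y X⊆Z Y⊆Z
      = cases (m≤n⇒m<n∨m≡n (Lo⇒≤ loX hX)) (m≤n⇒m<n∨m≡n (Lo⇒≤ loY hY))
      where
      later : ∀ {j X} → i < j → Lo j X → X ⊆ Z → ∣ S (suc i) ─ Z ∣ < ρ (suc i)
      later {j} {X} i<j (_ , _ , ∣S─X∣<ρ) X⊆Z = begin-strict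
        ∣ S (suc i) ─ Z ∣  ≤⟨ p⊆q⇒∣p∣≤∣q∣ (⊆-trans (p─-mono Z (S-mono i<j)) (─p-antimono (S j) X⊆Z)) ⟩
        ∣ S j ─ X ∣        <⟨ ∣S─X∣<ρ ⟩
        ρ (suc j)          ≤⟨ ρ-antimono (s≤s (<⇒≤ i<j)) ⟩
        ρ (suc i)          ∎
        where open ≤-Reasoning
      cases : i < j ⊎ i ≡ j → i < j′ ⊎ i ≡ j′ → ∣ S (suc i) ─ Z ∣ < ρ (suc i)
      cases (inj₁ i<j) _ = later i<j loX X⊆Z
      cases (inj₂ _) (inj₁ i<j′) = later i<j′ loY Y⊆Z
      cases (inj₂ refl) (inj₂ refl) with ∣ S (suc i) ─ Z ∣ <? ρ (suc i)
      ... | yes h = h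
      ... | no ≮ρ = ⊥-elim (X⊈Y X⊆Y)
        where
        S─Y⊆S─Z : S (suc i) ─ Y ⊆ S (suc i) ─ Z
        S─Y⊆S─Z = ⊆∧∣≥∣⇒⊇ (─p-antimono (S (suc i)) Y⊆Z)
          (≤-trans (≤-reflexive (proj₁ (proj₂ loY))) (≮⇒≥ ≮ρ))
        X⊆Y : X ⊆ Y
        X⊆Y {x} x∈X with x ∈? Y
        ... | yes x∈Y = x∈Y
        ... | no  x∉Y = contradiction (X⊆Z x∈X) (proj₂ (x∈p─q⁻ (S (suc i)) Z
          (S─Y⊆S─Z (x∈p∧x∉q⇒x∈p─q (proj₁ loX x∈X) x∉Y))))

    -- Dual to `Lo-pair`: both indices are at most `i`, and `S i ─ Z` contains both complements. A
    -- complement with smaller index is large enough by itself; if both indices are `i` and the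
    -- bound fails, then `S i ─ Z` equals the complement of `X` and contains that of `Y`, so
    -- `X ⊆ Y`.
    Up-pair : ∀ {i j j′ X Y Z} → i < k →
      ρ (suc i) ≤ ∣ S (suc i) ─ X ∣ → ρ (suc i) ≤ ∣ S (suc i) ─ Y ∣ →
      Up j X → Up j′ Y → ¬ X ⊆ Y → Z ⊆ X → Z ⊆ Y → ρ i ≤ ∣ S i ─ Z ∣
    Up-pair {i} {j} {j′} {X} {Y} {Z} i<k hX hY upX upY X⊈Y Z⊆X Z⊆Y
      = cases (m≤n⇒m<n∨m≡n (Up⇒≤ upX hX)) (m≤n⇒m<n∨m≡n (Up⇒≤ upY hY))
      where
      ∁⊆S─Z : ∀ {j X} → j ≤ i → Up j X → Z ⊆ X → ∁ X ⊆ S i ─ Z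
      ∁⊆S─Z j≤i (∁X⊆S , _) Z⊆X x∈ =
        x∈p∧x∉q⇒x∈p─q (S-mono j≤i (∁X⊆S x∈)) (x∈∁p⇒x∉p x∈ ∘ Z⊆X)
      earlier : ∀ {j X} → j < i → Up j X → Z ⊆ X → ρ i ≤ ∣ S i ─ Z ∣
      earlier {j} {X} j<i up Z⊆X = ≤-trans
        -- The strict decrease of `ρ` makes up for the point by which `∁ X` falls short of its
        -- threshold.
        (s≤s⁻¹ (subst (ρ i <_) (sym (proj₂ up)) (ρ-strict (<-trans j<i i<k) j<i)))
        (p⊆q⇒∣p∣≤∣q∣ (∁⊆S─Z (<⇒≤ j<i) up Z⊆X))
      cases : j < i ⊎ j ≡ i → j′ < i ⊎ j′ ≡ i → ρ i ≤ ∣ S i ─ Z ∣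
      cases (inj₁ j<i) _ = earlier j<i upX Z⊆X
      cases (inj₂ _) (inj₁ j′<i) = earlier j′<i upY Z⊆Y
      cases (inj₂ refl) (inj₂ refl) with ρ i ≤? ∣ S i ─ Z ∣
      ... | yes h = h
      ... | no ≰ρ = ⊥-elim (X⊈Y X⊆Y)
        where
        S─Z⊆∁X : S i ─ Z ⊆ ∁ X
        S─Z⊆∁X = ⊆∧∣≥∣⇒⊇ (∁⊆S─Z ≤-refl upX Z⊆X)
          (s≤s⁻¹ (subst (∣ S i ─ Z ∣ <_) (sym (proj₂ upX)) (≰⇒> ≰ρ)))
        X⊆Y : X ⊆ Y
        X⊆Y {x} x∈X with x ∈? Y
        ... | yes x∈Y = x∈Y
        ... | no  x∉Y = contradiction x∈X (x∈∁p⇒x∉p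
          (S─Z⊆∁X (∁⊆S─Z ≤-refl upY Z⊆Y (x∉p⇒x∈∁p x∉Y))))

    -- The bounds on `X` and `Y` give `j′ ≤ i ≤ j`, so `∁ Y` lies in `S j`. Whatever the union
    -- misses is then in `S j ─ X`, which is too small.
    mixed : ∀ {i j j′ X Y} → ∣ S i ─ X ∣ < ρ i → ρ (suc i) ≤ ∣ S (suc i) ─ Y ∣ →
      ρ (suc i) ≤ ∣ S (suc i) ─ (X ∪ Y) ∣ → Lo j X → ¬ Up j′ Y
    mixed {i} {j} {j′} {X} {Y} hX hY hXY lo@(_ , _ , ∣S─X∣<ρ) up@(∁Y⊆S , _) =
      <-irrefl refl (begin-strict
        ρ (suc i)                    ≤⟨ hXY ⟩
        ∣ S (suc i) ─ (X ∪ Y) ∣      ≤⟨ p⊆q⇒∣p∣≤∣q∣ S─X∪Y⊆S─X ⟩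
        ∣ S j ─ X ∣                  <⟨ ∣S─X∣<ρ ⟩
        ρ (suc j)                    ≤⟨ ρ-antimono (s≤s i≤j) ⟩
        ρ (suc i)                    ∎)
      where
      open ≤-Reasoning
      i≤j : i ≤ j
      i≤j = Lo⇒≤ lo hX
      S─X∪Y⊆S─X : S (suc i) ─ (X ∪ Y) ⊆ S j ─ X
      S─X∪Y⊆S─X x∈ = let x∉ = proj₂ (x∈p─q⁻ (S (suc i)) (X ∪ Y) x∈) in
        x∈p∧x∉q⇒x∈p─q (S-mono (≤-trans (Up⇒≤ up hY) i≤j) (∁Y⊆S (x∉p⇒x∈∁p (x∉ ∘ q⊆p∪q X Y))))
          (x∉ ∘ p⊆p∪q Y)

    private
      side : ∀ {X} → Base X → (∃ λ j → j < k × Lo j X) ⊎ (∃ λ j → j < k × Up j X)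
      side (j , j<k , inj₁ lo) = inj₁ (j , j<k , lo)
      side (j , j<k , inj₂ up) = inj₂ (j , j<k , up)

    base-avoids : ¬ Tower Base 2 0 k ⊥ ⊤
    base-avoids t = climb k (+-identityʳ k) λ X _ → ≤-<-trans (∣p─q∣≤∣p∣ (S 0) X) ∣S₀∣<ρ₀
      where
      open Tower t
      -- The bound `X` is arbitrary instead of a member of a layer, because it is later taken to be
      -- the union or the intersection of the two members of a layer, or `⊤`.
      Below Above : ℕ → Set
      Below i = ∀ X → (∀ {j} b → j < i → layer j b ⊆ X) → ∣ S i ─ X ∣ < ρ i
      Above i = ∀ X → (∀ {j} b → i ≤ j → j < k → X ⊆ layer j b) → ρ i ≤ ∣ S i ─ X ∣

      0b 1b : Fin 2
      0b = zero
      1b = suc zero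

      incomparable : ∀ {i} → i < k → ¬ layer i 0b ⊆ layer i 1b
      incomparable i<k ⊆₀₁ with () ← antichain 0b 1b z≤n i<k ⊆₀₁

      below : ∀ {i} b → i < k → Below i → ∣ S i ─ layer i b ∣ < ρ i
      below b i<k h = h _ λ c j<i → monotone c b z≤n j<i i<k

      above : ∀ {i} b → Above (suc i) → ρ (suc i) ≤ ∣ S (suc i) ─ layer i b ∣
      above b h = h _ λ c i<j j<k → monotone b c z≤n i<j j<k

      above-step : ∀ {i} → i < k → (∀ b → ∃ λ j → j < k × Up j (layer i b)) →
        Above (suc i) → Above i
      above-step i<k ups h X X⊆ with _ , _ , up₀ ← ups 0b | _ , _ , up₁ ← ups 1b =
        Up-pair i<k (above 0b h) (above 1b h) up₀ up₁ (incomparable i<k)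
          (X⊆ 0b ≤-refl i<k) (X⊆ 1b ≤-refl i<k)

      -- Downward induction from `k`, where `Above k` holds because `ρ k` is 0.
      descend : ∀ d {i} → d + i ≡ k →
        (∀ {j} b → i ≤ j → j < k → ∃ λ l → l < k × Up l (layer j b)) → Above i
      descend zero    refl _   X _ = subst (_≤ ∣ S k ─ X ∣) (sym ρk≡0) z≤n
      descend (suc d) {i} eq ups = above-step i<k (λ b → ups b ≤-refl i<k)
        (descend d (trans (+-suc d i) eq) λ b i<j → ups b (<⇒≤ i<j))
        where
        i<k : i < k
        i<k = subst (i <_) eq (m<n+m i z<s)

      -- By `Up⊈Lo`, one `Up` set forces every layer above it to consist of `Up` sets, so `descend`
      -- applies.
      Up⇒Above : ∀ {i j} b → i < k → j < k → Up j (layer i b) → Above (suc i)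
      Up⇒Above {i} b i<k j<k up = descend (k ∸ suc i) (m∸n+n≡m i<k) λ c i<l l<k →
        [ (λ (_ , j′<k , lo) → ⊥-elim (Up⊈Lo j′<k lo j<k up (monotone b c z≤n i<l l<k)))
            , (λ u → u) ] (side (member c z≤n l<k))

      no-mix : ∀ {i j j′} b c → i < k → j′ < k → Below i →
        Lo j (layer i b) → ¬ Up j′ (layer i c)
      no-mix b c i<k j′<k h lo up = mixed (below b i<k h) (above c h′)
        -- The union of the two members lies below all later layers, so `Above` also bounds its
        -- deficit.
        (h′ _ λ d i<l l<k x∈ → [ monotone b d z≤n i<l l<k , monotone c d z≤n i<l l<k ]
          (x∈p∪q⁻ _ _ x∈)) lo up
        where h′ = Up⇒Above c i<k j′<k up

      climb : ∀ d {i} → d + i ≡ k → ¬ Below i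
      climb zero    refl h = n≮0 (subst (∣ S k ─ ⊤ ∣ <_) ρk≡0 (h ⊤ λ _ _ → ⊆⊤))
      climb (suc d) {i} eq h
        with i<k ← subst (i <_) eq (m<n+m i z<s)
        with side (member 0b z≤n i<k) | side (member 1b z≤n i<k)
      ... | inj₁ (_ , _ , lo₀) | inj₁ (_ , _ , lo₁) =
        climb d (trans (+-suc d i) eq) λ X ⊆X →
          Lo-pair (below 0b i<k h) (below 1b i<k h) lo₀ lo₁ (incomparable i<k)
            (⊆X 0b (n<1+n i)) (⊆X 1b (n<1+n i))
      ... | inj₁ (_ , _ , lo₀) | inj₂ (_ , j<k , up₁) = no-mix 0b 1b i<k j<k h lo₀ up₁
      ... | inj₂ (_ , j<k , up₀) | inj₁ (_ , _ , lo₁) = no-mix 1b 0b i<k j<k h lo₁ up₀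
      -- The intersection of the two members lies above all earlier layers and below all layers from
      -- `i` on, so its deficit would be both less than `ρ i` and at least `ρ i`.
      ... | inj₂ (j , j<k , up₀) | inj₂ (j′ , j′<k , up₁) =
        <⇒≱ (h X λ b j<i x∈ → x∈p∩q⁺ (monotone b 0b z≤n j<i i<k x∈ , monotone b 1b z≤n j<i i<k x∈))
          (above-step i<k ups (Up⇒Above 0b i<k j<k up₀) X X⊆)
        where
        X : Subset n
        X = layer i 0b ∩ layer i 1b
        ups : ∀ b → ∃ λ j → j < k × Up j (layer i b)
        ups zero       = j , j<k , up₀
        ups (suc zero) = j′ , j′<k , up₁
        X⊆layer : ∀ b → X ⊆ layer i b
        X⊆layer zero       = p∩q⊆p _ _
        X⊆layer (suc zero) = p∩q⊆q _ _
        X⊆ : ∀ {j} b → i ≤ j → j < k → X ⊆ layer j b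
        X⊆ b i≤j j<k with m≤n⇒m<n∨m≡n i≤j
        ... | inj₁ i<j  = ⊆-trans (X⊆layer 0b) (monotone 0b b z≤n i<j j<k)
        ... | inj₂ refl = X⊆layer b

_≟ˢ_ : ∀ {n} (p q : Subset n) → Dec (p ≡ q)
_≟ˢ_ = Vec.≡-dec _≟ᵇ_

-- Supplies the point `x₀` that separates `Up` from `Lo`.
∉initial : ∀ {n s} (s<n : s < n) → fromℕ< s<n ∉ initial n s
∉initial {suc n} {zero}  _         h         = ∉⊥ h
∉initial {suc n} {suc s} (s≤s s<n) (there h) = ∉initial s<n h

-- Decidability of containment and greedy completion

-- Only predicates respecting `_≈_` are searched: a function rebuilt from enumerated values agrees
-- with the original pointwise, and need not be propositionally equal to it.
Searchable : (A : Set) → (A → A → Set) → Set₁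
Searchable A _≈_ = ∀ {P : A → Set} → (∀ {x y} → x ≈ y → P x → P y) →
  (∀ x → Dec (P x)) → Dec (∃ P)

Π-searchable : ∀ {m} {A : Fin m → Set} {_≈_ : ∀ {i} → A i → A i → Set} →
  (∀ {i} {x : A i} → x ≈ x) → (∀ i → Searchable (A i) _≈_) →
  Searchable (∀ i → A i) (λ f g → ∀ i → f i ≈ g i)
Π-searchable {zero} {A} _ _ {P} resp P? = map′ (nil ,_) (λ (_ , p) → resp (λ ()) p) (P? nil)
  where
  nil : ∀ i → A i
  nil ()
Π-searchable {suc m} {A} {_≈_} rfl search {P} resp P? = map′
  (λ (x , g , p) → cons x g , p)
  (λ (f , p) → f zero , f ∘ suc , resp (λ { zero → rfl ; (suc _) → rfl }) p)
  (search zero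
    (λ x≈y (g , p) → g , resp (λ { zero → x≈y ; (suc _) → rfl }) p)
    λ x → Π-searchable rfl (search ∘ suc)
      (λ f≈g → resp λ { zero → rfl ; (suc i) → f≈g i })
      λ g → P? (cons x g))
  where
  cons : A zero → (∀ i → A (suc i)) → ∀ i → A i
  cons x g zero    = x
  cons x g (suc i) = g i

module _ {n k : ℕ} {ns : Fin k → ℕ} where

  private
    Embeds : Family n → (KElem k ns → Subset n) → Set
    Embeds F f = (∀ x → f x ∈ˡ F)
      × (∀ x y → f x ≡ f y → x ≡ y)
      × (∀ x y → (f x ⊆ f y) ⇔ (x ≤K y))

    embeds-resp : ∀ {F f g} → (∀ i a → f (i , a) ≡ g (i , a)) → Embeds F f → Embeds F g
    embeds-resp {F} {f} {g} f≡g (mem , inj , ord) =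
        (λ x → subst (_∈ˡ F) (eq x) (mem x))
      , (λ x y gx≡gy → inj x y (trans (eq x) (trans gx≡gy (sym (eq y)))))
      , λ x y → subst₂ (λ p q → (p ⊆ q) ⇔ (x ≤K y)) (eq x) (eq y) (ord x y)
      where
      eq : ∀ x → f x ≡ g x
      eq (i , a) = f≡g i a

    all? : ∀ {P : KElem k ns → Set} → (∀ x → Dec (P x)) → Dec (∀ x → P x)
    all? P? = map′ uncurry (λ h i a → h (i , a)) (Fin.all? λ i → Fin.all? λ a → P? (i , a))

    _≟ᵏ_ : (x y : KElem k ns) → Dec (x ≡ y)
    _≟ᵏ_ = Product.≡-dec Fin._≟_ Fin._≟_

    embeds? : ∀ F f → Dec (Embeds F f)
    embeds? F f = all? (λ x → member? _≟ˢ_ (f x) F)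
      ×-dec all? (λ x → all? λ y → (f x ≟ˢ f y) →-dec (x ≟ᵏ y))
      ×-dec all? λ x → all? λ y → map′ (λ (to , from) → mk⇔ to from)
        (λ e → Equivalence.to e , Equivalence.from e)
        (((f x ⊆? f y) →-dec (x ≤K? y)) ×-dec ((x ≤K? y) →-dec (f x ⊆? f y)))
      where
      _≤K?_ : ∀ x y → Dec (x ≤K y)
      x ≤K? y = (x ≟ᵏ y) ⊎-dec (proj₁ x Fin.<? proj₁ y)

  -- Currying turns a candidate embedding into a function on layers whose values are functions into
  -- the searchable type of subsets, so `Π-searchable` applies twice.
  contains? : ∀ F → Dec (ContainsInducedK n k ns F)
  contains? F = map′ (λ (f , e) → uncurry f , e) (λ (f , e) → (λ i a → f (i , a)) , e)
    (Π-searchable {_≈_ = λ f g → ∀ a → f a ≡ g a} (λ _ → refl)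
      (λ i → Π-searchable {_≈_ = _≡_} refl λ _ _ → anySubset?)
      (embeds-resp {F}) (λ f → embeds? F (uncurry f)))

  contains-mono : ∀ {F G : Family n} → (∀ {X} → X ∈ˡ F → X ∈ˡ G) →
    ContainsInducedK n k ns F → ContainsInducedK n k ns G
  contains-mono F⊆G (f , mem , rest) = f , F⊆G ∘ mem , rest

  -- Greedy pass over `L`, adding a set whenever no copy arises. A set once refused remains refused,
  -- because by `contains-mono` the copy it creates survives in the larger final family.
  complete : ∀ L (F : Family n) → Unique F → ¬ ContainsInducedK n k ns F →
    Σ[ G ∈ Family n ] ((∀ {X} → X ∈ˡ F → X ∈ˡ G) × Unique G × ¬ ContainsInducedK n k ns G
      × (∀ {X} → X ∈ˡ L → X ∉ˡ G → ContainsInducedK n k ns (X ∷ G)))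
  complete []      F F! F-free = F , (λ h → h) , F! , F-free , λ ()
  complete (X ∷ L) F F! F-free with member? _≟ˢ_ X F | contains? (X ∷ F)
  ... | yes X∈F | _ with G , F⊆G , G! , G-free , sat ← complete L F F! F-free =
    G , F⊆G , G! , G-free , λ
      { (here refl) X∉G → contradiction (F⊆G X∈F) X∉G
      ; (there Y∈L) → sat Y∈L }
  ... | no _ | yes c with G , F⊆G , G! , G-free , sat ← complete L F F! F-free =
    G , F⊆G , G! , G-free , λ
      { (here refl) _ → contains-mono (λ { (here eq) → here eq ; (there h) → there (F⊆G h) }) c
      ; (there Y∈L) → sat Y∈L }
  ... | no X∉F | no ¬c with G , F⊆G , G! , G-free , sat ← complete L (X ∷ F) (¬Any⇒All¬ F X∉F ∷ F!) ¬c =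
    G , F⊆G ∘ there , G! , G-free , λ
      { (here refl) X∉G → contradiction (F⊆G (here refl)) X∉G
      ; (there Y∈L) → sat Y∈L }

  -- Induced copies versus towers

  module _ (2≤ns : ∀ i → 2 ≤ ns i) where

    -- Two elements of each layer are kept, which is what `base-avoids` refutes. The value `⊥` for
    -- indices from `k` on is a filler outside the range of the tower conditions.
    contains⇒tower : ∀ {F : Family n} {P : Subset n → Set} → (∀ {X} → X ∈ˡ F → P X) →
      ContainsInducedK n k ns F → Tower P 2 0 k ⊥ ⊤
    contains⇒tower {P = P} F⇒P (f , mem , inj , ord) = record
      { layer     = λ i → at (i <? k)
      ; member    = λ {i} a _ i<k → at-member (i <? k) a i<k
      ; lower     = λ _ _ _ → ⊥⊆
      ; upper     = λ _ _ _ → ⊆⊤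
      ; antichain = λ {i} a b _ i<k → at-antichain (i <? k) a b i<k
      ; monotone  = λ {i} {j} a b _ i<j j<k → at-monotone (i <? k) (j <? k) a b i<j j<k
      }
      where
      el : ∀ {i} → i < k → Fin 2 → KElem k ns
      el i<k a = fromℕ< i<k , inject≤ a (2≤ns (fromℕ< i<k))
      at : ∀ {i} → Dec (i < k) → Fin 2 → Subset n
      at (yes i<k) a = f (el i<k a)
      at (no _)    _ = ⊥
      ,-injectiveʳ : ∀ {i} {a b : Fin (ns i)} → (KElem k ns ∋ i , a) ≡ (i , b) → a ≡ b
      ,-injectiveʳ refl = refl
      at-member : ∀ {i} (d : Dec (i < k)) a → i < k → P (at d a)
      at-member (yes i<k) a _   = F⇒P (mem _)
      at-member (no  i≮k) _ i<k = contradiction i<k i≮k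
      at-antichain : ∀ {i} (d : Dec (i < k)) a b → i < k → at d a ⊆ at d b → a ≡ b
      at-antichain (yes i<k) a b _ h with Equivalence.to (ord (el i<k a) (el i<k b)) h
      ... | inj₁ eq  = Fin.inject≤-injective _ _ a b (,-injectiveʳ eq)
      ... | inj₂ i<i = contradiction i<i (<-irrefl refl)
      at-antichain (no i≮k) _ _ i<k = contradiction i<k i≮k
      at-monotone : ∀ {i j} (d : Dec (i < k)) (e : Dec (j < k)) a b → i < j → j < k → at d a ⊆ at e b
      at-monotone (yes i<k) (yes j<k) a b i<j _ = Equivalence.from (ord (el i<k a) (el j<k b))
        (inj₂ (subst₂ _<_ (sym (Fin.toℕ-fromℕ< i<k)) (sym (Fin.toℕ-fromℕ< j<k)) i<j))
      at-monotone (no i≮k) _        _ _ i<j j<k = contradiction (<-trans i<j j<k) i≮k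
      at-monotone (yes _)  (no j≮k) _ _ _   j<k = contradiction j<k j≮k

    -- The order must also be reflected. If a member of layer `i` were contained in member `b` of an
    -- earlier layer `j`, another member `c` of layer `j` would lie below both and hence inside `b`,
    -- against the antichain condition; `2≤ns` provides `c`.
    tower⇒contains : ∀ {m} {F : Family n} → (∀ i → ns i ≤ m) →
      Tower (_∈ˡ F) m 0 k ⊥ ⊤ → ContainsInducedK n k ns F
    tower⇒contains ns≤m t = f
      , (λ (i , a) → member _ z≤n (Fin.toℕ<n i))
      , f-injective
      , λ x y → mk⇔ (reflect x y) (preserve x y)
      where
      open Tower t
      f : KElem k ns → Subset n
      f (i , a) = layer (toℕ i) (inject≤ a (ns≤m i))
      f-antichain : ∀ i a b → f (i , a) ⊆ f (i , b) → a ≡ b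
      f-antichain i a b h = Fin.inject≤-injective _ _ a b (antichain _ _ z≤n (Fin.toℕ<n i) h)
      other : ∀ {l} → 2 ≤ l → (a : Fin l) → ∃ λ b → b ≢ a
      other (s≤s (s≤s _)) zero    = suc zero , λ ()
      other (s≤s (s≤s _)) (suc a) = zero , λ ()
      preserve : ∀ x y → x ≤K y → f x ⊆ f y
      preserve x       _       (inj₁ refl) = ⊆-refl
      preserve (i , a) (j , b) (inj₂ i<j)  = monotone _ _ z≤n i<j (Fin.toℕ<n j)
      reflect : ∀ x y → f x ⊆ f y → x ≤K y
      reflect (i , a) (j , b) h with Fin.<-cmp i j
      ... | tri< i<j _ _ = inj₂ i<j
      ... | tri≈ _ refl _ = inj₁ (cong (i ,_) (f-antichain i a b h))
      ... | tri> _ _ j<i with c , c≢b ← other (2≤ns j) b =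
        contradiction (f-antichain j c b (⊆-trans (preserve (j , c) (i , a) (inj₂ j<i)) h)) c≢b
      f-injective : ∀ x y → f x ≡ f y → x ≡ y
      f-injective x y eq with reflect x y (⊆-reflexive eq) | reflect y x (⊆-reflexive (sym eq))
      ... | inj₁ x≡y | _        = x≡y
      ... | inj₂ _   | inj₁ y≡x = sym y≡x
      ... | inj₂ i<j | inj₂ j<i = contradiction j<i (<-asym i<j)

-- Counting by fibres

lookup-injective : ∀ {A : Set} {xs : List A} → Unique xs → ∀ i j → lookup xs i ≡ lookup xs j → i ≡ j
lookup-injective (_  ∷ _)  zero    zero    _  = refl
lookup-injective (px ∷ _)  zero    (suc j) eq = contradiction eq (All.lookup px (∈-lookup j))
lookup-injective (px ∷ _)  (suc i) zero    eq = contradiction (sym eq) (All.lookup px (∈-lookup i))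
lookup-injective (_  ∷ u)  (suc i) (suc j) eq = cong suc (lookup-injective u i j eq)

length≤filter+filter : ∀ {A : Set} {P : A → Set} (P? : ∀ x → Dec (P x)) xs →
  length xs ≤ length (filter P? xs) + length (filter (¬? ∘ P?) xs)
length≤filter+filter P? [] = z≤n
length≤filter+filter P? (x ∷ xs) with P? x
... | yes _ = s≤s (length≤filter+filter P? xs)
... | no  _ = subst (suc (length xs) ≤_) (sym (+-suc _ _)) (s≤s (length≤filter+filter P? xs))

-- The fibres are split off one key at a time. `P` carries what is already known into the fibre
-- bound, so that the lemma can be nested: first by cardinality, then by trace.
length≤fibres : ∀ {A B : Set} {P : A → Set} {b} (_≟_ : (y z : B) → Dec (y ≡ z)) (key : A → B) →
  (∀ y zs → Unique zs → (∀ {x} → x ∈ˡ zs → P x × key x ≡ y) → length zs ≤ b) →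
  ∀ ys xs → Unique xs → (∀ {x} → x ∈ˡ xs → P x × key x ∈ˡ ys) → length xs ≤ length ys * b
length≤fibres _≟_ key fibre []       []       _  _ = z≤n
length≤fibres _≟_ key fibre []       (x ∷ xs) _  h with () ← proj₂ (h (here refl))
length≤fibres {A} {B} {P} {b} _≟_ key fibre (y ∷ ys) xs xs! h = begin
  length xs                                            ≤⟨ length≤filter+filter y? xs ⟩
  length (filter y? xs) + length (filter (¬? ∘ y?) xs) ≤⟨ +-mono-≤
    (fibre y _ (filter⁺ y? xs!) λ x∈ → let x∈xs , eq = ∈-filter⁻ y? x∈ in proj₁ (h x∈xs) , eq)
    (length≤fibres _≟_ key fibre ys _ (filter⁺ (¬? ∘ y?) xs!) rest) ⟩
  b + length ys * b                                    ∎
  where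
  open ≤-Reasoning
  y? : ∀ x → Dec (key x ≡ y)
  y? x = key x ≟ y
  rest : ∀ {x} → x ∈ˡ filter (¬? ∘ y?) xs → P x × key x ∈ˡ ys
  rest x∈ with x∈xs , ≢y ← ∈-filter⁻ (¬? ∘ y?) x∈ with h x∈xs
  ... | px , here eq = contradiction eq ≢y
  ... | px , there k∈ = px , k∈

-- The linear bound

upper-bound : ∀ {k} (f : Fin k → ℕ) → Σ[ m ∈ ℕ ] (∀ i → f i ≤ m)
upper-bound {zero}  f = 0 , λ ()
upper-bound {suc k} f with m , f≤m ← upper-bound (f ∘ suc) = f zero ⊔ m , λ
  { zero    → m≤m⊔n (f zero) m
  ; (suc i) → ≤-trans (f≤m i) (m≤n⊔m (f zero) m) }

theorem4p1 : (k : ℕ) → 1 ≤ k → (ns : Fin k → ℕ) → (∀ i → 2 ≤ ns i) →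
    Σ[ C ∈ ℕ ] Σ[ N₀ ∈ ℕ ] (∀ n → N₀ ≤ n →
    Σ[ F ∈ Family n ] (Unique F × Saturated n k ns F × length F ≤ C * n))
theorem4p1 k 1≤k ns 2≤ns with m , ns≤m ← upper-bound ns =
  -- `b` bounds the members of one cardinality: at most `m` for each of the `2 ^ size k` traces. The
  -- factor 2 absorbs the `suc n` cardinalities, and `n` must exceed `size k` to leave a point
  -- outside `S k`.
  2 * b , suc (size k) , λ n size<n → family n size<n
  where
  0<m : 0 < m
  0<m = ≤-trans (≤-trans (n≤1+n 1) (2≤ns (fromℕ< 1≤k))) (ns≤m (fromℕ< 1≤k))
  open Threshold k 0<m
  b : ℕ
  b = 2 ^ size k * m

  family : ∀ n → size k < n → Σ[ F ∈ Family n ] (Unique F × Saturated n k ns F × length F ≤ 2 * b * n)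
  family n size<n = saturated (complete (powerset ⊤) F₀ F₀! F₀-free)
    where
    S : ℕ → Subset n
    S = initial n ∘ size
    S-mono : ∀ {i j} → i ≤ j → S i ⊆ S j
    S-mono i≤j = initial-mono n (size-mono i≤j)
    ∣S∣ : ∀ {i} → i ≤ k → ∣ S i ∣ ≡ size i
    ∣S∣ i≤k = ∣initial∣ (≤-trans (size-mono i≤k) (<⇒≤ size<n))
    S-gap : ∀ {i} → i < k → ρ i ≤ ∣ S (suc i) ─ S i ∣
    S-gap {i} i<k = +-cancelʳ-≤ (size i) (ρ i) _ (begin
      ρ i + size i                      ≡⟨ +-comm (ρ i) (size i) ⟩
      size (suc i)                      ≡⟨ ∣S∣ i<k ⟨
      ∣ S (suc i) ∣                     ≤⟨ ∣p∣≤∣p─q∣+∣q∣ (S (suc i)) (S i) ⟩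
      ∣ S (suc i) ─ S i ∣ + ∣ S i ∣     ≡⟨ cong (∣ S (suc i) ─ S i ∣ +_) (∣S∣ (<⇒≤ i<k)) ⟩
      ∣ S (suc i) ─ S i ∣ + size i      ∎)
      where open ≤-Reasoning
    ∣S₀∣<ρ₀ : ∣ S 0 ∣ < ρ 0
    ∣S₀∣<ρ₀ = subst₂ _<_ (sym (∣S∣ z≤n)) (sym (ρ-step 1≤k)) (<-≤-trans 0<m (m≤m+n m (ρ 1)))

    open Scaffold k 0<m S
    open Embed S-mono S-gap
    open Avoid S-mono ∣S₀∣<ρ₀ (∉initial size<n)

    F₀ : Family n
    F₀ = deduplicate _≟ˢ_ (filter base? (powerset ⊤))
    F₀! : Unique F₀
    F₀! = deduplicate-! _≟ˢ_ _
    base⇒F₀ : ∀ {X} → Base X → X ∈ˡ F₀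
    base⇒F₀ = ∈-deduplicate⁺ _≟ˢ_ ∘ ∈-filter⁺ base? (∈-powerset ⊆⊤)
    F₀⇒base : ∀ {X} → X ∈ˡ F₀ → Base X
    F₀⇒base X∈ = proj₂ (∈-filter⁻ base? {xs = powerset ⊤} (∈-deduplicate⁻ _≟ˢ_ _ X∈))
    F₀-free : ¬ ContainsInducedK n k ns F₀
    F₀-free = base-avoids ∘ contains⇒tower 2≤ns F₀⇒base

    bounded : ∀ F → (∀ {X} → X ∈ˡ F₀ → X ∈ˡ F) → Unique F → ¬ ContainsInducedK n k ns F →
      length F ≤ 2 * b * n
    bounded F F₀⊆F F! F-free = begin
      length F                       ≤⟨ length≤fibres _≟_ ∣_∣ level (upTo (suc n)) F F!
                                          (λ {X} X∈F → X∈F , ∈-upTo⁺ (s≤s (∣p∣≤n X))) ⟩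
      length (upTo (suc n)) * b      ≡⟨ cong (_* b) (length-upTo (suc n)) ⟩
      suc n * b                      ≤⟨ *-monoˡ-≤ b (+-monoˡ-≤ n (≤-trans (s≤s z≤n) size<n)) ⟩
      (n + n) * b                    ≡⟨ cong (λ l → (n + l) * b) (+-identityʳ n) ⟨
      2 * n * b                      ≡⟨ *-assoc 2 n b ⟩
      2 * (n * b)                    ≡⟨ cong (2 *_) (*-comm n b) ⟩
      2 * (b * n)                    ≡⟨ *-assoc 2 b n ⟨
      2 * b * n                      ∎
      where
      open ≤-Reasoning
      trace : Subset n → Subset n
      trace X = S k ∩ X
      -- Distinct sets of equal cardinality form an antichain; with a common trace, `m` of them
      -- would be completed by `fullTower` to a forbidden copy in `F`.
      same-trace : ∀ c Y zs → Unique zs →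
        (∀ {X} → X ∈ˡ zs → (X ∈ˡ F × ∣ X ∣ ≡ c) × trace X ≡ Y) → length zs ≤ m
      same-trace c Y zs zs! h = ≮⇒≥ λ m<len → F-free
        (tower⇒contains 2≤ns ns≤m (fullTower ∣S₀∣<ρ₀ (F₀⊆F ∘ base⇒F₀)
          (X m<len) (λ a → proj₁ (proj₁ (h (X∈zs m<len a)))) (λ a → proj₂ (h (X∈zs m<len a)))
          (X-antichain m<len)))
        where
        X : m < length zs → Fin m → Subset n
        X m<len a = lookup zs (inject≤ a (<⇒≤ m<len))
        X∈zs : ∀ m<len a → X m<len a ∈ˡ zs
        X∈zs m<len a = ∈-lookup (inject≤ a (<⇒≤ m<len))
        X-antichain : ∀ m<len a b → X m<len a ⊆ X m<len b → a ≡ b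
        X-antichain m<len a b X⊆X = Fin.inject≤-injective _ _ a b (lookup-injective zs! _ _
          (⊆-antisym X⊆X (⊆∧∣≥∣⇒⊇ X⊆X (≤-reflexive (trans (proj₂ (proj₁ (h (X∈zs m<len b))))
            (sym (proj₂ (proj₁ (h (X∈zs m<len a))))))))))
      level : ∀ c zs → Unique zs → (∀ {X} → X ∈ˡ zs → X ∈ˡ F × ∣ X ∣ ≡ c) → length zs ≤ b
      level c zs zs! h = subst (λ l → length zs ≤ l * m)
        (trans (length-powerset (S k)) (cong (2 ^_) (∣S∣ ≤-refl)))
        (length≤fibres _≟ˢ_ trace (same-trace c) (powerset (S k)) zs zs!
          λ {X} X∈ → h X∈ , ∈-powerset (p∩q⊆p (S k) X))

    saturated : (Σ[ F ∈ Family n ] ((∀ {X} → X ∈ˡ F₀ → X ∈ˡ F) × Unique F × ¬ ContainsInducedK n k ns F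
        × (∀ {X} → X ∈ˡ powerset ⊤ → X ∉ˡ F → ContainsInducedK n k ns (X ∷ F)))) →
      Σ[ F ∈ Family n ] (Unique F × Saturated n k ns F × length F ≤ 2 * b * n)
    saturated (F , F₀⊆F , F! , F-free , sat) =
      F , F! , (F-free , λ X → sat (∈-powerset ⊆⊤)) , bounded F F₀⊆F F! F-free
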